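{- Let $m \geq 1$ be an integer. Then $\alpha(C(F_{m,1}))=\alpha(C(P_{m}))+1$.
   Context: Graphs are finite and simple. For a graph $G$, the pair graph $C(G)$ (also called complete double vertex graph) is the graph whose vertices are all $2$-multisets of $V(G)$ (so $\{x,x\}$ is allowed), where two vertices $\{x,y\}$ and $\{u,v\}$ are adjacent if and only if $\{x,y\}\cap\{u,v\}=\{a\}$ (multiset intersection) for some $a$ and, writing $x=u=a$, the vertices $y$ and $v$ are adjacent in $G$; that is, the two multisets can be written as $\{a,y\}$ and $\{a,v\}$ with $yv$ an edge of $G$. $P_m$ is the path graph with $m$ vertices ($P_1$ is a single vertex). The fan graph $F_{m,1}$ is the join $P_m+K_1$, where $K_1$ is the complete graph with one vertex (the join of two disjoint graphs adds all edges between them). $\alpha(G)$ denotes the independence number of $G$. -}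

module Defs where

open import Data.Fin.Base using (Fin; toℕ)
import Data.Fin.Properties as Fin
open import Data.List.Base using (List; []; _∷_; _++_; map; length; filter; allFin; cartesianProduct)
open import Data.List.Membership.Propositional.Properties using (∈-allFin)
import Data.List.Membership.Setoid as SetoidMembership
import Data.List.Membership.Setoid.Properties as SetoidMembershipₚ
open import Data.List.Properties using (length-filter; filter-all)
import Data.List.Relation.Unary.All as All
open import Data.List.Relation.Unary.AllPairs using ([]; _∷_)
open import Data.List.Relation.Unary.Any as Any using (here; there)
import Data.List.Relation.Unary.Enumerates.Setoid as Enumerates
import Data.List.Relation.Unary.Enumerates.Setoid.Properties as Enumeratesₚ
import Data.List.Relation.Unary.Unique.Setoid as SetoidUnique
import Data.List.Relation.Unary.Unique.Setoid.Properties as SetoidUniqueₚ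
open import Data.Nat.Base using (ℕ; suc; _≤_; z≤n; s≤s)
import Data.Nat.Properties as ℕ
open import Data.Product.Base using (Σ; ∃-syntax; _×_; _,_; proj₁; proj₂)
open import Data.Sum.Base using (_⊎_; inj₁; inj₂)
open import Data.Sum.Relation.Binary.Pointwise using (⊎-decSetoid; inj₁; inj₂)
open import Data.Unit.Base using (⊤; tt)
open import Level using (0ℓ)
open import Relation.Binary.Bundles using (DecSetoid)
open import Relation.Binary.Core using (Rel)
open import Relation.Binary.Definitions using (Decidable; Symmetric; _Respects₂_)
open import Relation.Binary.PropositionalEquality as ≡ using (_≡_; _≢_; refl)
open import Relation.Nullary using (¬_; yes; no; contradiction)
open import Relation.Nullary.Decidable using (map′; _×-dec_; _⊎-dec_; ¬?)
import Relation.Unary as U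

-- Vertices form a setoid, not a type with _≡_, because the vertices of the
-- pair graph are unordered pairs.  The enumeration may repeat vertices.
record Graph : Set₁ where
  infix 4 _~_ _~?_
  field
    vertexDecSetoid : DecSetoid 0ℓ 0ℓ

  open DecSetoid vertexDecSetoid public
    renaming (Carrier to Vertex; setoid to vertexSetoid
             ; refl to ≈-refl; sym to ≈-sym; trans to ≈-trans)
    using (_≈_; _≉_; _≟_)

  field
    _~_      : Rel Vertex 0ℓ
    ~-resp-≈ : _~_ Respects₂ _≈_
    ~-sym    : Symmetric _~_
    ~-irrefl : ∀ {x} → ¬ (x ~ x)
    _~?_     : Decidable _~_
    vertices   : List Vertex
    enumerates : Enumerates.IsEnumeration vertexSetoid vertices

  open SetoidMembership vertexSetoid public using (_∈_)
  open SetoidUnique vertexSetoid public using (Unique)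

path : ℕ → Graph
path m = record
  { vertexDecSetoid = Fin.≡-decSetoid m
  ; _~_        = λ i j → suc (toℕ i) ≡ toℕ j ⊎ suc (toℕ j) ≡ toℕ i
  ; ~-resp-≈   = (λ { refl p → p }) , (λ { refl p → p })
  ; ~-sym      = λ { (inj₁ p) → inj₂ p ; (inj₂ p) → inj₁ p }
  ; ~-irrefl   = λ { (inj₁ p) → ℕ.1+n≢n p ; (inj₂ p) → ℕ.1+n≢n p }
  ; _~?_       = λ i j → (suc (toℕ i) ℕ.≟ toℕ j) ⊎-dec (suc (toℕ j) ℕ.≟ toℕ i)
  ; vertices   = allFin m
  ; enumerates = ∈-allFin
  }

complete : ℕ → Graph
complete n = record
  { vertexDecSetoid = Fin.≡-decSetoid n
  ; _~_        = _≢_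
  ; ~-resp-≈   = (λ { refl p → p }) , (λ { refl p → p })
  ; ~-sym      = ≡.≢-sym
  ; ~-irrefl   = λ x≢x → x≢x refl
  ; _~?_       = λ i j → ¬? (i Fin.≟ j)
  ; vertices   = allFin n
  ; enumerates = ∈-allFin
  }

module _ (G H : Graph) where
  private
    module G = Graph G
    module H = Graph H

  JoinAdjacent : Rel (G.Vertex ⊎ H.Vertex) 0ℓ
  JoinAdjacent (inj₁ x) (inj₁ y) = x G.~ y
  JoinAdjacent (inj₁ _) (inj₂ _) = ⊤
  JoinAdjacent (inj₂ _) (inj₁ _) = ⊤
  JoinAdjacent (inj₂ x) (inj₂ y) = x H.~ y

  join : Graph
  join = record
    { vertexDecSetoid = ds
    ; _~_        = JoinAdjacent
    ; ~-resp-≈   = (λ {x} {y} {z} → respʳ {x} {y} {z}) , (λ {x} {y} {z} → respˡ {x} {y} {z})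
    ; ~-sym      = λ {x} {y} → symm {x} {y}
    ; ~-irrefl   = λ {x} → irr {x}
    ; _~?_       = dec
    ; vertices   = map inj₁ G.vertices ++ map inj₂ H.vertices
    ; enumerates = Enumeratesₚ.++⁺ G.vertexSetoid H.vertexSetoid G.enumerates H.enumerates
    }
    where
    ds = ⊎-decSetoid G.vertexDecSetoid H.vertexDecSetoid
    open DecSetoid ds using (_≈_)

    symm : ∀ {x y} → JoinAdjacent x y → JoinAdjacent y x
    symm {inj₁ _} {inj₁ _} p = G.~-sym p
    symm {inj₁ _} {inj₂ _} p = tt
    symm {inj₂ _} {inj₁ _} p = tt
    symm {inj₂ _} {inj₂ _} p = H.~-sym p

    irr : ∀ {x} → ¬ JoinAdjacent x x
    irr {inj₁ _} p = G.~-irrefl p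
    irr {inj₂ _} p = H.~-irrefl p

    respʳ : ∀ {x y z} → y ≈ z → JoinAdjacent x y → JoinAdjacent x z
    respʳ {inj₁ _} (inj₁ e) p = proj₁ G.~-resp-≈ e p
    respʳ {inj₂ _} (inj₁ e) p = tt
    respʳ {inj₁ _} (inj₂ e) p = tt
    respʳ {inj₂ _} (inj₂ e) p = proj₁ H.~-resp-≈ e p

    respˡ : ∀ {x y z} → y ≈ z → JoinAdjacent y x → JoinAdjacent z x
    respˡ {x} {y} {z} e p = symm {x} {z} (respʳ {x} e (symm {y} {x} p))

    dec : Decidable JoinAdjacent
    dec (inj₁ x) (inj₁ y) = x G.~? y
    dec (inj₁ _) (inj₂ _) = yes tt
    dec (inj₂ _) (inj₁ _) = yes tt
    dec (inj₂ x) (inj₂ y) = x H.~? y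

fan : ℕ → ℕ → Graph
fan m n = join (path m) (complete n)

-- The 2-multiset {x , y} is represented by the pair (x , y), taken up to _≈₂_.
module Pair (G : Graph) where
  open Graph G

  infix 4 _≈₂_ _~₂_

  _≈₂_ : Rel (Vertex × Vertex) 0ℓ
  (x , y) ≈₂ (u , v) = (x ≈ u × y ≈ v) ⊎ (x ≈ v × y ≈ u)

  -- Since y ~ v forces y ≉ v, the multiset intersection of {a , y} and
  -- {a , v} is then automatically the singleton {a}.
  _~₂_ : Rel (Vertex × Vertex) 0ℓ
  p ~₂ q = ∃[ a ] ∃[ y ] ∃[ v ] (p ≈₂ (a , y) × q ≈₂ (a , v) × y ~ v)

  ≈₂-sym : Symmetric _≈₂_
  ≈₂-sym (inj₁ (p , q)) = inj₁ (≈-sym p , ≈-sym q)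
  ≈₂-sym (inj₂ (p , q)) = inj₂ (≈-sym q , ≈-sym p)

  ≈₂-trans : ∀ {p q r} → p ≈₂ q → q ≈₂ r → p ≈₂ r
  ≈₂-trans (inj₁ (a , b)) (inj₁ (c , d)) = inj₁ (≈-trans a c , ≈-trans b d)
  ≈₂-trans (inj₁ (a , b)) (inj₂ (c , d)) = inj₂ (≈-trans a c , ≈-trans b d)
  ≈₂-trans (inj₂ (a , b)) (inj₁ (c , d)) = inj₂ (≈-trans a d , ≈-trans b c)
  ≈₂-trans (inj₂ (a , b)) (inj₂ (c , d)) = inj₁ (≈-trans a d , ≈-trans b c)

  multisetDecSetoid : DecSetoid 0ℓ 0ℓ
  multisetDecSetoid = record
    { Carrier = Vertex × Vertex
    ; _≈_     = _≈₂_
    ; isDecEquivalence = record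
      { isEquivalence = record
        { refl  = inj₁ (≈-refl , ≈-refl)
        ; sym   = ≈₂-sym
        ; trans = ≈₂-trans
        }
      ; _≟_ = λ (x , y) (u , v) → ((x ≟ u) ×-dec (y ≟ v)) ⊎-dec ((x ≟ v) ×-dec (y ≟ u))
      }
    }

  irrefl₂ : ∀ {p} → ¬ (p ~₂ p)
  irrefl₂ (a , y , v , e , f , y~v) with ≈₂-trans (≈₂-sym e) f
  ... | inj₁ (_ , y≈v)   = ~-irrefl (proj₁ ~-resp-≈ (≈-sym y≈v) y~v)
  ... | inj₂ (a≈v , y≈a) = ~-irrefl (proj₁ ~-resp-≈ (≈-sym (≈-trans y≈a a≈v)) y~v)

  _~₂?_ : Decidable _~₂_
  (x , y) ~₂? (u , v) = map′ to from
    ( ((x ≟ u) ×-dec (y ~? v)) ⊎-dec ((x ≟ v) ×-dec (y ~? u))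
      ⊎-dec ((y ≟ u) ×-dec (x ~? v)) ⊎-dec ((y ≟ v) ×-dec (x ~? u)) )
    where
    Cases = (x ≈ u × y ~ v) ⊎ (x ≈ v × y ~ u) ⊎ (y ≈ u × x ~ v) ⊎ (y ≈ v × x ~ u)

    to : Cases → (x , y) ~₂ (u , v)
    to (inj₁ (e , r)) = x , y , v , inj₁ (≈-refl , ≈-refl) , inj₁ (≈-sym e , ≈-refl) , r
    to (inj₂ (inj₁ (e , r))) = x , y , u , inj₁ (≈-refl , ≈-refl) , inj₂ (≈-refl , ≈-sym e) , r
    to (inj₂ (inj₂ (inj₁ (e , r)))) = y , x , v , inj₂ (≈-refl , ≈-refl) , inj₁ (≈-sym e , ≈-refl) , r
    to (inj₂ (inj₂ (inj₂ (e , r)))) = y , x , u , inj₂ (≈-refl , ≈-refl) , inj₂ (≈-refl , ≈-sym e) , r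

    move : ∀ {b b′ c c′} → b ≈ b′ → c ≈ c′ → b′ ~ c′ → b ~ c
    move e f r = proj₂ ~-resp-≈ (≈-sym e) (proj₁ ~-resp-≈ (≈-sym f) r)

    from : (x , y) ~₂ (u , v) → Cases
    from (_ , _ , _ , inj₁ (e , f) , inj₁ (g , h) , r) = inj₁ (≈-trans e (≈-sym g) , move f h r)
    from (_ , _ , _ , inj₁ (e , f) , inj₂ (g , h) , r) = inj₂ (inj₁ (≈-trans e (≈-sym h) , move f g r))
    from (_ , _ , _ , inj₂ (e , f) , inj₁ (g , h) , r) = inj₂ (inj₂ (inj₁ (≈-trans f (≈-sym g) , move e h r)))
    from (_ , _ , _ , inj₂ (e , f) , inj₂ (g , h) , r) = inj₂ (inj₂ (inj₂ (≈-trans f (≈-sym h) , move e g r)))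

C : Graph → Graph
C G = record
  { vertexDecSetoid = multisetDecSetoid
  ; _~_        = _~₂_
  ; ~-resp-≈   = (λ q≈q′ (a , y , v , e , f , r) → a , y , v , e , ≈₂-trans (≈₂-sym q≈q′) f , r)
               , (λ p≈p′ (a , y , v , e , f , r) → a , y , v , ≈₂-trans (≈₂-sym p≈p′) e , f , r)
  ; ~-sym      = λ (a , y , v , e , f , r) → a , v , y , f , e , ~-sym r
  ; ~-irrefl   = irrefl₂
  ; _~?_       = _~₂?_
  ; vertices   = cartesianProduct vertices vertices
  ; enumerates = λ p → Any.map inj₁
      (Enumeratesₚ.cartesianProduct⁺ vertexSetoid vertexSetoid enumerates enumerates p)
  }
  where
  open Graph G
  open Pair G

module _ (G : Graph) where
  open Graph G

  -- A finite set of vertices is a list without repetitions (up to _≈_), so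
  -- that its length is its cardinality.
  IsIndependentSet : List Vertex → Set
  IsIndependentSet S = Unique S × (∀ {x y} → x ∈ S → y ∈ S → ¬ (x ~ y))

  IsIndependenceNumber : ℕ → Set
  IsIndependenceNumber k =
    (∃[ S ] (IsIndependentSet S × length S ≡ k)) ×
    (∀ S → IsIndependentSet S → length S ≤ k)

module _ (G : Graph) where
  open Graph G
  private
    infix 4 _⊑_
    _⊑_ : List Vertex → List Vertex → Set
    S ⊑ xs = ∀ {v} → v ∈ S → v ∈ xs

    MaximumIn : List Vertex → Set
    MaximumIn xs = ∃[ S ] (IsIndependentSet G S × S ⊑ xs ×
                     (∀ T → IsIndependentSet G T → T ⊑ xs → length T ≤ length S))

    module Step (x : Vertex) where
      Other : Vertex → Set
      Other y = x ≉ y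

      other? : U.Decidable Other
      other? y = ¬? (x ≟ y)

      other-resp : ∀ {y z} → y ≈ z → Other y → Other z
      other-resp y≈z x≉y x≈z = x≉y (≈-trans x≈z (≈-sym y≈z))

      Free : Vertex → Set
      Free y = x ≉ y × ¬ (x ~ y)

      free? : U.Decidable Free
      free? y = ¬? (x ≟ y) ×-dec ¬? (x ~? y)

      free-resp : ∀ {y z} → y ≈ z → Free y → Free z
      free-resp y≈z (x≉y , x≁y) =
        other-resp y≈z x≉y , λ x~z → x≁y (proj₁ ~-resp-≈ (≈-sym y≈z) x~z)

      length-others : ∀ T → Unique T → length T ≤ suc (length (filter other? T))
      length-others []      _ = z≤n
      length-others (y ∷ T) (y∉T ∷ uT) with x ≟ y
      ... | no  x≉y = s≤s (length-others T uT)
      ... | yes x≈y = s≤s (ℕ.≤-reflexive (≡.cong length (≡.sym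
              (filter-all other? (All.map (λ y≉z x≈z → y≉z (≈-trans (≈-sym x≈y) x≈z)) y∉T)))))

    maximumIn : ∀ n xs → length xs ≤ n → MaximumIn xs
    maximumIn _ [] _ = [] , ([] , λ ()) , (λ ()) , bound
      where
      bound : ∀ T → IsIndependentSet G T → T ⊑ [] → length T ≤ 0
      bound []      _ _  = z≤n
      bound (t ∷ T) _ T⊑ with () ← T⊑ (here ≈-refl)
    maximumIn (suc n) (x ∷ xs) (s≤s l)
      with maximumIn n xs l
         | maximumIn n (filter (Step.free? x) xs) (ℕ.≤-trans (length-filter (Step.free? x) xs) l)
    ... | S , iS , S⊑ , maxS | R , (uR , iR) , R⊑ , maxR = choose
      where
      open Step x
      open SetoidMembershipₚ

      R⊑′ : ∀ {v} → v ∈ R → v ∈ xs × Free v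
      R⊑′ v∈R = ∈-filter⁻ vertexSetoid free? free-resp (R⊑ v∈R)

      indep : ∀ {u v} → u ∈ x ∷ R → v ∈ x ∷ R → ¬ (u ~ v)
      indep (here u≈x) (here v≈x) r = ~-irrefl (proj₂ ~-resp-≈ u≈x (proj₁ ~-resp-≈ v≈x r))
      indep (here u≈x) (there v∈R) r = proj₂ (proj₂ (R⊑′ v∈R)) (proj₂ ~-resp-≈ u≈x r)
      indep (there u∈R) (here v≈x) r = proj₂ (proj₂ (R⊑′ u∈R)) (~-sym (proj₁ ~-resp-≈ v≈x r))
      indep (there u∈R) (there v∈R) = iR u∈R v∈R

      ix∷R : IsIndependentSet G (x ∷ R)
      ix∷R = (All.tabulateₛ vertexSetoid (λ v∈R → proj₁ (proj₂ (R⊑′ v∈R))) ∷ uR) , indep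

      bound : ∀ T → IsIndependentSet G T → T ⊑ x ∷ xs →
              length T ≤ length S ⊎ length T ≤ suc (length R)
      bound T (uT , iT) T⊑ with Any.any? (x ≟_) T
      ... | no x∉T = inj₁ (maxS T (uT , iT) λ {v} v∈T → drop v∈T (T⊑ v∈T))
        where
        drop : ∀ {v} → v ∈ T → v ∈ x ∷ xs → v ∈ xs
        drop v∈T (here v≈x)   = contradiction (∈-resp-≈ vertexSetoid v≈x v∈T) x∉T
        drop v∈T (there v∈xs) = v∈xs
      ... | yes x∈T = inj₂ (ℕ.≤-trans (length-others T uT) (s≤s (maxR T′ (uT′ , iT′) T′⊑)))
        where
        T′ = filter other? T
        T′⁻ : ∀ {v} → v ∈ T′ → v ∈ T × Other v
        T′⁻ = ∈-filter⁻ vertexSetoid other? other-resp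
        uT′ : Unique T′
        uT′ = SetoidUniqueₚ.filter⁺ vertexSetoid other? uT
        iT′ : ∀ {u v} → u ∈ T′ → v ∈ T′ → ¬ (u ~ v)
        iT′ u∈ v∈ = iT (proj₁ (T′⁻ u∈)) (proj₁ (T′⁻ v∈))
        drop : ∀ {v} → Other v → v ∈ x ∷ xs → v ∈ xs
        drop x≉v (here v≈x)   = contradiction (≈-sym v≈x) x≉v
        drop x≉v (there v∈xs) = v∈xs
        T′⊑ : T′ ⊑ filter free? xs
        T′⊑ v∈T′ with v∈T , x≉v ← T′⁻ v∈T′ =
          ∈-filter⁺ vertexSetoid free? free-resp (drop x≉v (T⊑ v∈T)) (x≉v , iT x∈T v∈T)

      choose : MaximumIn (x ∷ xs)
      choose with ℕ.≤-total (length S) (suc (length R))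
      ... | inj₁ S≤R = x ∷ R , ix∷R , sub , λ T iT T⊑ → pick (bound T iT T⊑)
        where
        sub : x ∷ R ⊑ x ∷ xs
        sub (here e)    = here e
        sub (there v∈R) = there (proj₁ (R⊑′ v∈R))
        pick : ∀ {k} → k ≤ length S ⊎ k ≤ suc (length R) → k ≤ suc (length R)
        pick (inj₁ p) = ℕ.≤-trans p S≤R
        pick (inj₂ p) = p
      ... | inj₂ R≤S = S , iS , (λ v∈S → there (S⊑ v∈S)) , λ T iT T⊑ → pick (bound T iT T⊑)
        where
        pick : ∀ {k} → k ≤ length S ⊎ k ≤ suc (length R) → k ≤ length S
        pick (inj₁ p) = p
        pick (inj₂ p) = ℕ.≤-trans p R≤S

  independenceNumber : Σ ℕ (IsIndependenceNumber G)
  independenceNumber with S , iS , _ , maxS ← maximumIn (length vertices) vertices ℕ.≤-refl =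
    length S , (S , iS , refl) , λ T iT → maxS T iT (λ {v} _ → enumerates v)

α : Graph → ℕ
α G = proj₁ (independenceNumber G)

{-# OPTIONS --safe #-}

-- The hub h of the join contributes to the pair graph the vertices {h , h} and
-- {x , h}.  Since {h , h} is adjacent only to the {x , h}, it can be added to
-- every independent set of C(G).  Conversely, drop {h , h} from an independent
-- set of C(G + K₁) and replace each {x , h} by {x , x}.  As {x , h} is adjacent
-- to all {x , y} with y in G, this is injective and the result is independent
-- in C(G).

module Submission where

open import Defs using (path; fan; C; α)
open import Defs using (Graph; complete; join; module Pair; IsIndependentSet; independenceNumber)
open import Data.Fin.Base using (zero)
open import Data.List.Base using (List; []; _∷_; map; mapMaybe; length)
open import Data.List.Properties using (length-map)
import Data.List.Relation.Unary.All as All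
open import Data.List.Relation.Unary.All using (All; []; _∷_)
import Data.List.Relation.Unary.All.Properties as Allₚ
import Data.List.Relation.Unary.AllPairs as AllPairs
open import Data.List.Relation.Unary.AllPairs using (AllPairs; []; _∷_)
import Data.List.Relation.Unary.AllPairs.Properties as AllPairsₚ
open import Data.List.Relation.Unary.Any using (here; there)
open import Data.Maybe.Base using (Maybe; just; nothing)
open import Data.Nat.Base using (ℕ; suc; _+_; _≤_; _≥_; z≤n; s≤s)
import Data.Nat.Properties as ℕ
open import Data.Product.Base using (_×_; _,_; proj₁; proj₂)
open import Data.Sum.Base as Sum using (_⊎_; inj₁; inj₂)
open import Data.Sum.Relation.Binary.Pointwise using (inj₁; inj₂)
open import Data.Unit.Base using (tt)
open import Function.Base using (_∘_)
open import Relation.Binary.PropositionalEquality using (_≡_; refl; trans; subst)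
open import Relation.Nullary using (¬_; contradiction)

module Separation (G : Graph) where
  open Graph G

  -- Equality and adjacency are merged into one relation, so that having no repetition and having no
  -- edge become a single `AllPairs` condition. Being positive, `Clash` can be carried along maps by
  -- case analysis; `Separated` then follows by contraposition.
  Clash : Vertex → Vertex → Set
  Clash x y = x ≈ y ⊎ x ~ y

  Separated : Vertex → Vertex → Set
  Separated x y = ¬ Clash x y

  Clash-sym : ∀ {x y} → Clash x y → Clash y x
  Clash-sym = Sum.map ≈-sym ~-sym

  Clash-respʳ : ∀ {x y z} → y ≈ z → Clash x y → Clash x z
  Clash-respʳ y≈z = Sum.map (λ x≈y → ≈-trans x≈y y≈z) (proj₁ ~-resp-≈ y≈z)

  Clash-respˡ : ∀ {x y z} → y ≈ z → Clash y x → Clash z x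
  Clash-respˡ y≈z = Clash-sym ∘ Clash-respʳ y≈z ∘ Clash-sym

  independent⇒separated : ∀ {S} → IsIndependentSet G S → AllPairs Separated S
  independent⇒separated {[]}    _ = []
  independent⇒separated {x ∷ S} (x∉S ∷ uS , iS) =
    All.zipWith (λ (x≉y , x≁y) → Sum.[ x≉y , x≁y ])
      (x∉S , All.tabulateₛ vertexSetoid (λ y∈S → iS (here ≈-refl) (there y∈S)))
    ∷ independent⇒separated (uS , λ x∈S y∈S → iS (there x∈S) (there y∈S))

  separated⇒independent : ∀ {S} → AllPairs Separated S → IsIndependentSet G S
  separated⇒independent sS = AllPairs.map (_∘ inj₁) sS , nonadjacent sS
    where
    separated-∈ : ∀ {x y S} → All (Separated x) S → y ∈ S → Separated x y
    separated-∈ p y∈S = All.lookupₛ vertexSetoid (λ y≈z → _∘ Clash-respʳ (≈-sym y≈z)) p y∈S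

    nonadjacent : ∀ {S x y} → AllPairs Separated S → x ∈ S → y ∈ S → ¬ (x ~ y)
    -- Both memberships point to the same entry, about which `AllPairs` says nothing; irreflexivity
    -- settles it.
    nonadjacent (p ∷ s) (here x≈) (here y≈) r =
      ~-irrefl (proj₂ ~-resp-≈ x≈ (proj₁ ~-resp-≈ y≈ r))
    nonadjacent (p ∷ s) (here x≈) (there y∈) r =
      separated-∈ p y∈ (Clash-respˡ x≈ (inj₂ r))
    nonadjacent (p ∷ s) (there x∈) (here y≈) r =
      separated-∈ p x∈ (Clash-respˡ y≈ (inj₂ (~-sym r)))
    nonadjacent (p ∷ s) (there x∈) (there y∈) r = nonadjacent s x∈ y∈ r

  separated-length≤α : ∀ {S} → AllPairs Separated S → length S ≤ α G
  separated-length≤α sS = proj₂ (proj₂ (independenceNumber G)) _ (separated⇒independent sS)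

-- The equations restrict the preservation hypothesis to entries that `f` keeps.
mapMaybe-allPairs⁺ : ∀ {A B : Set} {R : A → A → Set} {Q : B → B → Set} (f : A → Maybe B) →
  (∀ {x y u v} → f x ≡ just u → f y ≡ just v → R x y → Q u v) →
  ∀ {xs} → AllPairs R xs → AllPairs Q (mapMaybe f xs)
mapMaybe-allPairs⁺ f pres [] = []
mapMaybe-allPairs⁺ {R = R} {Q} f pres {x ∷ xs} (p ∷ ps) with f x in fx
... | nothing = mapMaybe-allPairs⁺ f pres ps
... | just u  = related p ∷ mapMaybe-allPairs⁺ f pres ps
  where
  related : ∀ {ys} → All (R x) ys → All (Q u) (mapMaybe f ys)
  related [] = []
  related {y ∷ ys} (r ∷ rs) with f y in fy
  ... | nothing = related rs
  ... | just v  = pres fx fy r ∷ related rs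

module _ (G : Graph) where
  private
    G+K₁ : Graph
    G+K₁ = join G (complete 1)
    module G = Graph G
    module J = Graph G+K₁
    module CG = Separation (C G)
    module CJ = Separation (C G+K₁)
    open Pair G using () renaming (_≈₂_ to _≈ᴳ_)
    open Pair G+K₁ using () renaming (_≈₂_ to _≈ᴶ_)

    pattern hub = inj₂ zero

    lift : G.Vertex × G.Vertex → J.Vertex × J.Vertex
    lift (x , y) = inj₁ x , inj₁ y

    lift-≈⁺ : ∀ {p q} → p ≈ᴳ q → lift p ≈ᴶ lift q
    lift-≈⁺ (inj₁ (e , f)) = inj₁ (inj₁ e , inj₁ f)
    lift-≈⁺ (inj₂ (e , f)) = inj₂ (inj₁ e , inj₁ f)

    lift-≈⁻ : ∀ {p q} → lift p ≈ᴶ lift q → p ≈ᴳ q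
    lift-≈⁻ (inj₁ (inj₁ e , inj₁ f)) = inj₁ (e , f)
    lift-≈⁻ (inj₂ (inj₁ e , inj₁ f)) = inj₂ (e , f)

    lift-clash⁺ : ∀ {p q} → CG.Clash p q → CJ.Clash (lift p) (lift q)
    lift-clash⁺ (inj₁ e) = inj₁ (lift-≈⁺ e)
    lift-clash⁺ (inj₂ (a , y , v , e , f , r)) =
      inj₂ (inj₁ a , inj₁ y , inj₁ v , lift-≈⁺ e , lift-≈⁺ f , r)

    -- The vertices that witness an adjacency all lie in the two lifted multisets, which avoid the
    -- hub. The edge between them is therefore already an edge of `G`.
    lift-clash⁻ : ∀ {p q} → CJ.Clash (lift p) (lift q) → CG.Clash p q
    lift-clash⁻ (inj₁ e) = inj₁ (lift-≈⁻ e)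
    lift-clash⁻ (inj₂ (inj₁ a , inj₁ y , inj₁ v , e , f , r)) =
      inj₂ (a , y , v , lift-≈⁻ e , lift-≈⁻ f , r)
    lift-clash⁻ (inj₂ (inj₂ _ , _ , _ , inj₁ (() , _) , _))
    lift-clash⁻ (inj₂ (inj₂ _ , _ , _ , inj₂ (_ , ()) , _))
    lift-clash⁻ (inj₂ (inj₁ _ , inj₂ _ , _ , inj₁ (_ , ()) , _))
    lift-clash⁻ (inj₂ (inj₁ _ , inj₂ _ , _ , inj₂ (() , _) , _))
    lift-clash⁻ (inj₂ (inj₁ _ , inj₁ _ , inj₂ _ , _ , inj₁ (_ , ()) , _))
    lift-clash⁻ (inj₂ (inj₁ _ , inj₁ _ , inj₂ _ , _ , inj₂ (() , _) , _))

    -- Equal or adjacent multisets share an element, whereas the only element of `(hub , hub)` is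
    -- absent from `lift p`.
    hub²-separated : ∀ p → CJ.Separated (hub , hub) (lift p)
    hub²-separated p (inj₁ (inj₁ (() , _)))
    hub²-separated p (inj₁ (inj₂ (() , _)))
    hub²-separated p (inj₂ (inj₁ _ , _ , _ , inj₁ (() , _) , _))
    hub²-separated p (inj₂ (inj₁ _ , _ , _ , inj₂ (_ , ()) , _))
    hub²-separated p (inj₂ (inj₂ _ , _ , _ , _ , inj₁ (() , _) , _))
    hub²-separated p (inj₂ (inj₂ _ , _ , _ , _ , inj₂ (_ , ()) , _))

    collapse : J.Vertex × J.Vertex → Maybe (G.Vertex × G.Vertex)
    collapse (inj₁ x , inj₁ y) = just (x , y)
    collapse (inj₁ x , hub)    = just (x , x)
    collapse (hub , inj₁ x)    = just (x , x)
    collapse (hub , hub)       = nothing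

    -- Whatever clashes with `(x , x)` contains `x`. Its other element is joined to the hub, which
    -- gives the adjacency.
    clash-with-hub : ∀ {p x} → CG.Clash p (x , x) → CJ.Clash (lift p) (inj₁ x , hub)
    clash-with-hub {p} {x} c = meet (shared c)
      where
      shared : CG.Clash p (x , x) → proj₁ p G.≈ x ⊎ proj₂ p G.≈ x
      shared (inj₁ (inj₁ (e , _))) = inj₁ e
      shared (inj₁ (inj₂ (e , _))) = inj₁ e
      shared (inj₂ (a , _ , _ , e , f , _)) = Sum.map (to-x ∘ proj₁) (to-x ∘ proj₂) e
        where
        x≈a : x G.≈ a
        x≈a = Sum.[ proj₁ , proj₂ ] f

        to-x : ∀ {z} → z G.≈ a → z G.≈ x
        to-x z≈a = G.≈-trans z≈a (G.≈-sym x≈a)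

      meet : proj₁ p G.≈ x ⊎ proj₂ p G.≈ x → CJ.Clash (lift p) (inj₁ x , hub)
      meet (inj₁ e) = inj₂
        (inj₁ x , inj₁ (proj₂ p) , hub , inj₁ (inj₁ e , J.≈-refl) , inj₁ (J.≈-refl , J.≈-refl) , tt)
      meet (inj₂ e) = inj₂
        (inj₁ x , inj₁ (proj₁ p) , hub , inj₂ (J.≈-refl , inj₁ e) , inj₁ (J.≈-refl , J.≈-refl) , tt)

    -- Two diagonal multisets are never adjacent: a shared element `a` would make both equal to
    -- `(a , a)`, and the required edge would be a loop.
    diagonal-clash⇒≈ : ∀ {x y} → CG.Clash (x , x) (y , y) → x G.≈ y
    diagonal-clash⇒≈ (inj₁ (inj₁ (e , _))) = e
    diagonal-clash⇒≈ (inj₁ (inj₂ (e , _))) = e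
    diagonal-clash⇒≈ {x} {y} (inj₂ (a , b , c , e , f , b~c)) =
      contradiction (proj₂ G.~-resp-≈ (equal e) (proj₁ G.~-resp-≈ (equal f) b~c)) G.~-irrefl
      where
      equal : ∀ {z b} → (z , z) ≈ᴳ (a , b) → b G.≈ a
      equal (inj₁ (z≈a , z≈b)) = G.≈-trans (G.≈-sym z≈b) z≈a
      equal (inj₂ (z≈b , z≈a)) = G.≈-trans (G.≈-sym z≈b) z≈a

    swap : ∀ {x y} → (x , y) ≈ᴶ (y , x)
    swap = inj₂ (J.≈-refl , J.≈-refl)

    -- By contraposition, `collapse` keeps separated multisets separated, hence also distinct. The
    -- cases depend on how many of `p` and `q` contain the hub: with none the clash lifts, with one
    -- the two are adjacent through the hub, with both they are equal.
    collapse-clash : ∀ {p q p′ q′} → collapse p ≡ just p′ → collapse q ≡ just q′ →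
                     CG.Clash p′ q′ → CJ.Clash p q
    collapse-clash {inj₁ _ , inj₁ _} {inj₁ _ , inj₁ _} refl refl c = lift-clash⁺ c
    collapse-clash {inj₁ _ , inj₁ _} {inj₁ _ , hub}    refl refl c = clash-with-hub c
    collapse-clash {inj₁ _ , inj₁ _} {hub , inj₁ _}    refl refl c =
      CJ.Clash-respʳ swap (clash-with-hub c)
    collapse-clash {inj₁ _ , hub}    {inj₁ _ , inj₁ _} refl refl c =
      CJ.Clash-sym (clash-with-hub (CG.Clash-sym c))
    collapse-clash {hub , inj₁ _}    {inj₁ _ , inj₁ _} refl refl c =
      CJ.Clash-sym (CJ.Clash-respʳ swap (clash-with-hub (CG.Clash-sym c)))
    collapse-clash {inj₁ _ , hub}    {inj₁ _ , hub}    refl refl c =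
      inj₁ (inj₁ (inj₁ (diagonal-clash⇒≈ c) , J.≈-refl))
    collapse-clash {inj₁ _ , hub}    {hub , inj₁ _}    refl refl c =
      inj₁ (inj₂ (inj₁ (diagonal-clash⇒≈ c) , J.≈-refl))
    collapse-clash {hub , inj₁ _}    {inj₁ _ , hub}    refl refl c =
      inj₁ (inj₂ (J.≈-refl , inj₁ (diagonal-clash⇒≈ c)))
    collapse-clash {hub , inj₁ _}    {hub , inj₁ _}    refl refl c =
      inj₁ (inj₁ (J.≈-refl , inj₁ (diagonal-clash⇒≈ c)))
    collapse-clash {hub , hub}       {_}               ()
    collapse-clash {inj₁ _ , inj₁ _} {hub , hub}       _ ()
    collapse-clash {inj₁ _ , hub}    {hub , hub}       _ ()
    collapse-clash {hub , inj₁ _}    {hub , hub}       _ ()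

    -- Only `(hub , hub)` is discarded, and it clashes with itself, so it cannot occur in `S`.
    length-collapse-lossless : ∀ {S} → All (CJ.Separated (hub , hub)) S →
                               length S ≤ length (mapMaybe collapse S)
    length-collapse-lossless [] = z≤n
    length-collapse-lossless {(inj₁ _ , inj₁ _) ∷ _} (_ ∷ ps) = s≤s (length-collapse-lossless ps)
    length-collapse-lossless {(inj₁ _ , hub) ∷ _}    (_ ∷ ps) = s≤s (length-collapse-lossless ps)
    length-collapse-lossless {(hub , inj₁ _) ∷ _}    (_ ∷ ps) = s≤s (length-collapse-lossless ps)
    length-collapse-lossless {(hub , hub) ∷ _}       (p ∷ _)  =
      contradiction (inj₁ (inj₁ (J.≈-refl , J.≈-refl))) p

    length-collapse : ∀ {S} → AllPairs CJ.Separated S →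
                      length S ≤ suc (length (mapMaybe collapse S))
    length-collapse [] = z≤n
    length-collapse {(inj₁ _ , inj₁ _) ∷ _} (_ ∷ ps) = s≤s (length-collapse ps)
    length-collapse {(inj₁ _ , hub) ∷ _}    (_ ∷ ps) = s≤s (length-collapse ps)
    length-collapse {(hub , inj₁ _) ∷ _}    (_ ∷ ps) = s≤s (length-collapse ps)
    -- The one permitted loss is spent here: the tail is separated from this entry and so loses
    -- nothing more.
    length-collapse {(hub , hub) ∷ _}       (p ∷ _)  = s≤s (length-collapse-lossless p)

    α-lower : suc (α (C G)) ≤ α (C G+K₁)
    α-lower with S , iS , |S|≡α ← proj₁ (proj₂ (independenceNumber (C G))) =
      subst (λ k → suc k ≤ α (C G+K₁)) (trans (length-map lift S) |S|≡α)
        (CJ.separated-length≤α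
          -- The new head of the list is `(hub , hub)`, determined by the type of `hub²-separated`.
          (Allₚ.map⁺ (All.universal hub²-separated S)
          ∷ AllPairsₚ.map⁺ (AllPairs.map (_∘ lift-clash⁻) (CG.independent⇒separated iS))))

    α-upper : α (C G+K₁) ≤ suc (α (C G))
    α-upper with S , iS , |S|≡α ← proj₁ (proj₂ (independenceNumber (C G+K₁))) = begin
      α (C G+K₁)                         ≡⟨ |S|≡α ⟨
      length S                           ≤⟨ length-collapse sS ⟩
      suc (length (mapMaybe collapse S)) ≤⟨ s≤s (CG.separated-length≤α
        (mapMaybe-allPairs⁺ collapse (λ {p} {q} ep eq → _∘ collapse-clash {p} {q} ep eq) sS)) ⟩
      suc (α (C G))                      ∎
      where
      open ℕ.≤-Reasoning
      sS = CJ.independent⇒separated iS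

  α-C-join-K₁ : α (C (join G (complete 1))) ≡ α (C G) + 1
  α-C-join-K₁ = trans (ℕ.≤-antisym α-upper α-lower) (ℕ.+-comm 1 (α (C G)))

theorem1p4 : ∀ (m : ℕ) → m ≥ 1 → α (C (fan m 1)) ≡ α (C (path m)) + 1
-- `fan m 1` unfolds to `join (path m) (complete 1)`.
theorem1p4 m _ = α-C-join-K₁ (path m)
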